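{- Let $u,v\in\mathbb{N}$, let $A$ be a $u\times v$ matrix with rational entries, and let $B$ be a $CR$-set in $(\mathbb{Z},+)$. Assume that for each $a\in\mathbb{Z}$ there exists $\vec{x}\in\mathbb{Z}^{v}$ such that $A\vec{x}=\overline{a}$, where $\overline{a}\in\mathbb{Z}^{u}$ is the vector all of whose entries equal $a$. Then $$\left\{\vec{y}\in\mathbb{Z}^{v}: A\vec{y}\in B^{u}\right\}$$ is a $CR$-set in $(\mathbb{Z}^{v},+)$.
   Context: $\mathbb{N}=\{1,2,3,\ldots\}$. For a set $X$, $\mathcal{P}_f(X)$ denotes the set of nonempty finite subsets of $X$, and ${}^{\mathbb{N}}S$ denotes the set of all functions (sequences) from $\mathbb{N}$ to $S$. Vectors are regarded as column vectors. Let $(S,+)$ be a commutative semigroup, $E\subseteq S$ and $k\in\mathbb{N}$. $E$ is a $k$-$CR$-set in $S$ if and only if there exists $r\in\mathbb{N}$ such that whenever $F\in\mathcal{P}_f({}^{\mathbb{N}}S)$ with $|F|\le k$, there exist $a\in S$ and $H\in\mathcal{P}_f(\{1,2,\ldots,r\})$ such that for all $f\in F$, $a+\sum_{t\in H}f(t)\in E$. $E$ is a $CR$-set (combinatorially rich set) in $S$ if and only if it is a $k$-$CR$-set for every $k\in\mathbb{N}$. (Equivalently: for each $k\in\mathbb{N}$ there exists $r\in\mathbb{N}$ such that for every $r\times k$ matrix $M=(m_{i,j})$ with entries from $S$ there exist $a\in S$ and a nonempty $H\subseteq\{1,\ldots,r\}$ such that $a+\sum_{t\in H}m_{t,j}\in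 E$ for each $j\in\{1,\ldots,k\}$.) -}

module Defs where

open import Algebra.Bundles using (CommutativeSemigroup)
open import Data.Bool.Base using (true; false)
open import Data.Fin.Base using (Fin; zero; suc; toℕ)
open import Data.Fin.Subset using (Subset; Nonempty)
open import Data.Integer.Base as ℤ using (ℤ)
import Data.Integer.Properties as ℤ
open import Data.List.NonEmpty.Base using (List⁺; length)
open import Data.List.NonEmpty.Relation.Unary.All using (All)
open import Data.Nat.Base using (ℕ; suc; NonZero; _≤_)
open import Data.Product.Base using (∃; ∃-syntax; _×_)
open import Data.Rational.Base as ℚ using (ℚ; 0ℚ)
open import Data.Rational.Literals using (fromℤ)
open import Data.Vec.Base using (Vec; []; _∷_; map; zipWith; foldr′)
open import Data.Vec.Properties using (zipWith-assoc; zipWith-comm)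
import Data.Vec.Relation.Unary.All as Vec
open import Function.Base using (_∘_)
open import Level using (Level; 0ℓ; _⊔_)
open import Relation.Binary.PropositionalEquality using (_≡_; cong₂; isEquivalence)
open import Relation.Unary using (Pred)

private
  variable
    c ℓ p : Level
    m n : ℕ

-- Sequences are indexed by the positive integers 1, 2, 3, …
Seq : Set c → Set c
Seq S = (n : ℕ) → .{{NonZero n}} → S

module _ (S : CommutativeSemigroup c ℓ) where

  open CommutativeSemigroup S

  -- a ⊹Σ[ H ] g is a + Σ_{t ∈ H} g t. The sum is accumulated starting from a,
  -- because a semigroup need not have a neutral element.
  infixl 6 _⊹Σ[_]_

  _⊹Σ[_]_ : Carrier → Subset n → (Fin n → Carrier) → Carrier
  a ⊹Σ[ [] ]        g = a
  a ⊹Σ[ true  ∷ H ] g = (a ∙ g zero) ⊹Σ[ H ] (g ∘ suc)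
  a ⊹Σ[ false ∷ H ] g = a ⊹Σ[ H ] (g ∘ suc)

  -- A nonempty finite set F of sequences with |F| ≤ k is given by an
  -- enumeration of length at most k; repetitions are allowed, since equality
  -- of sequences is not decidable. The element t of Fin r stands for the
  -- element suc (toℕ t) of {1, …, r}.
  Is-k-CR : ℕ → Pred Carrier p → Set (c ⊔ p)
  Is-k-CR k E =
    ∃[ r ] NonZero r ×
      ((F : List⁺ (Seq Carrier)) → length F ≤ k →
        ∃[ a ] ∃ λ (H : Subset r) → Nonempty H ×
          All (λ f → E (a ⊹Σ[ H ] (λ t → f (suc (toℕ t))))) F)

  IsCR : Pred Carrier p → Set (c ⊔ p)
  IsCR E = (k : ℕ) → .{{NonZero k}} → Is-k-CR k E

ℤ^-commutativeSemigroup : ℕ → CommutativeSemigroup 0ℓ 0ℓ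
ℤ^-commutativeSemigroup n = record
  { Carrier = Vec ℤ n
  ; _≈_     = _≡_
  ; _∙_     = zipWith ℤ._+_
  ; isCommutativeSemigroup = record
    { isSemigroup = record
      { isMagma = record
        { isEquivalence = isEquivalence
        ; ∙-cong        = cong₂ (zipWith ℤ._+_)
        }
      ; assoc = zipWith-assoc ℤ.+-assoc
      }
    ; comm = zipWith-comm ℤ.+-comm
    }
  }

-- A matrix is the vector of its rows.
Matrix : Set c → ℕ → ℕ → Set c
Matrix R m n = Vec (Vec R n) m

infixr 7 _*ᵥ_

_*ᵥ_ : Matrix ℚ m n → Vec ℚ n → Vec ℚ m
A *ᵥ x = map (λ row → foldr′ ℚ._+_ 0ℚ (zipWith ℚ._*_ row x)) A

-- { y ∈ ℤⁿ : A y ∈ Bᵐ }, where ℤᵐ is regarded as a subset of ℚᵐ: A y must be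
-- an integer vector with all entries in B.
Preimage : Matrix ℚ m n → Pred ℤ p → Pred (Vec ℤ n) p
Preimage {m = m} A B y =
  ∃ λ (b : Vec ℤ m) → Vec.All B b × A *ᵥ map fromℤ y ≡ map fromℤ b

{-# OPTIONS --safe #-}

-- Let d be a common denominator of the entries of A. The entries of d A y are
-- then integral functionals of y, and A y ∈ Bᵘ says that they lie in d B.
-- Among the d ^ K + 1 partial sums of a block of d ^ K terms of K integer
-- sequences, two agree modulo d in all K coordinates, so each block contains a
-- nonempty set over which all K sums are divisible by d. Applying the CR property
-- of B to the quotients of these sums by d gives a shift a and a union of such
-- sets; the shift a is lifted to ℤᵛ by a solution x of A x = ā.
module Submission where

open import Defs
open import Algebra.Bundles using (CommutativeSemigroup)
open import Algebra.Morphism.Definitions using (Homomorphic₂)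
open import Data.Bool.Base using (true; false)
open import Data.Fin.Base as Fin using (Fin; zero; suc; toℕ)
import Data.Fin.Properties as Fin
open import Data.Fin.Subset using (Subset; Nonempty; ⊥)
open import Data.Integer.Base as ℤ using (ℤ; +_; 0ℤ)
import Data.Integer.DivMod as ℤ
open import Data.Integer.Properties using (+-commutativeSemigroup)
import Data.Integer.Properties as ℤ
open import Data.Integer.Tactic.RingSolver using (solve-∀)
open import Data.List.Base as List using (List; []; _∷_)
import Data.List.Properties as List
open import Data.List.NonEmpty.Base using (_∷_)
open import Data.List.NonEmpty.Relation.Unary.All as List⁺ using (_∷_)
import Data.List.Relation.Unary.All as ListAll
import Data.List.Relation.Unary.All.Properties as ListAll
open import Data.Nat.Base as ℕ using (ℕ; zero; suc; NonZero; s≤s; s<s; _^_)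
open import Data.Nat.Divisibility using (_∣_; divides; m∣m*n; n∣m*n)
import Data.Nat.Properties as ℕ
open import Data.Product.Base using (∃; ∃-syntax; _×_; _,_; proj₁; proj₂)
open import Data.Rational.Base as ℚ using (ℚ; 0ℚ; toℚᵘ; ↥_; ↧_; ↧ₙ_)
import Data.Rational.Properties as ℚ
open import Data.Rational.Literals using (fromℤ)
import Data.Rational.Unnormalised.Base as ℚᵘ
import Data.Rational.Unnormalised.Properties as ℚᵘ
open import Data.Vec.Base
  using (Vec; []; _∷_; _++_; here; there; foldr′; lookup; map; replicate; tabulate; zipWith)
import Data.Vec.Properties as Vec
open import Data.Vec.Relation.Unary.All as VecAll using ([]; _∷_)
import Data.Vec.Relation.Unary.All.Properties as VecAll
open import Function.Base using (_∘_)
open import Level using (Level)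
open import Relation.Binary.PropositionalEquality
  using (_≡_; refl; sym; trans; cong; cong₂; module ≡-Reasoning)
open import Relation.Unary using (Pred)

private
  variable
    a p : Level
    X : Set a
    k m n r : ℕ

-- Index sets assembled from prefixes and blocks.

nonempty-++ˡ : {H : Subset m} (G : Subset n) → Nonempty H → Nonempty (H ++ G)
nonempty-++ˡ G (zero  , here)    = zero , here
nonempty-++ˡ G (suc i , there i∈H) with nonempty-++ˡ G (i , i∈H)
... | j , j∈ = suc j , there j∈

nonempty-++ʳ : (H : Subset m) {G : Subset n} → Nonempty G → Nonempty (H ++ G)
nonempty-++ʳ []      ne = ne
nonempty-++ʳ (x ∷ H) ne with nonempty-++ʳ H ne
... | j , j∈ = suc j , there j∈

-- The prefixes of `Fin n`, from the empty one to the full one: `n + 1` in all, one more than the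
-- number of residue vectors when `n` is `d ^ k`.
initial : Fin (suc n) → Subset n
initial         zero    = ⊥
initial {suc n} (suc i) = true ∷ initial i

-- `G` is defined on all of ℕ because the block sets are chosen before `H` is known; the recursion
-- then merely shifts it.
blocks : Subset r → (ℕ → Subset n) → Subset (r ℕ.* n)
blocks []          G = []
blocks (true  ∷ H) G = G 0 ++ blocks H (G ∘ suc)
blocks (false ∷ H) G = ⊥ ++ blocks H (G ∘ suc)

blocks-nonempty : {H : Subset r} (G : ℕ → Subset n) →
  Nonempty H → (∀ t → Nonempty (G t)) → Nonempty (blocks H G)
blocks-nonempty G (zero , here) ne = nonempty-++ˡ _ (ne 0)
blocks-nonempty {H = true ∷ H} G (suc i , there i∈H) ne =
  nonempty-++ʳ (G 0) (blocks-nonempty (G ∘ suc) (i , i∈H) (ne ∘ suc))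
blocks-nonempty {H = false ∷ H} G (suc i , there i∈H) ne =
  nonempty-++ʳ ⊥ (blocks-nonempty (G ∘ suc) (i , i∈H) (ne ∘ suc))

-- Sums over index sets, and the CR property for families indexed by `Fin k`.

module _ {c ℓ} (S : CommutativeSemigroup c ℓ) where

  open CommutativeSemigroup S
    using (Carrier; _≈_; _∙_; setoid; assoc; ∙-congˡ; ∙-congʳ; ∙-cong)
    renaming (refl to ≈-refl; sym to ≈-sym; trans to ≈-trans)

  private
    sum : Carrier → Subset n → (Fin n → Carrier) → Carrier
    sum = _⊹Σ[_]_ S

  Σ-cong : ∀ {a b} (H : Subset n) {g h : Fin n → Carrier} →
    a ≈ b → (∀ t → g t ≈ h t) → sum a H g ≈ sum b H h
  Σ-cong []          a≈b g≈h = a≈b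
  Σ-cong (true  ∷ H) a≈b g≈h = Σ-cong H (∙-cong a≈b (g≈h zero)) (g≈h ∘ suc)
  Σ-cong (false ∷ H) a≈b g≈h = Σ-cong H a≈b (g≈h ∘ suc)

  -- Reassociating at each selected term keeps `a` outermost in the accumulator. This lets a sum be
  -- detached from its starting value.
  Σ-∙ : ∀ a b (H : Subset n) g → sum (a ∙ b) H g ≈ a ∙ sum b H g
  Σ-∙ a b []          g = ≈-refl
  Σ-∙ a b (true  ∷ H) g =
    ≈-trans (Σ-cong H (assoc a b _) (λ _ → ≈-refl)) (Σ-∙ a _ H (g ∘ suc))
  Σ-∙ a b (false ∷ H) g = Σ-∙ a b H (g ∘ suc)

  Σ-⊥ : ∀ a (g : Fin n → Carrier) → sum a ⊥ g ≡ a
  Σ-⊥ {zero}  a g = refl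
  Σ-⊥ {suc n} a g = Σ-⊥ a (g ∘ suc)

  -- `h` lives on ℕ so that the second part reads the same sequence at offset `m`, without casts
  -- between index types.
  Σ-++ : ∀ a (H : Subset m) (G : Subset n) (h : ℕ → Carrier) →
    sum a (H ++ G) (h ∘ toℕ) ≡ sum (sum a H (h ∘ toℕ)) G (λ t → h (m ℕ.+ toℕ t))
  Σ-++ a []          G h = refl
  Σ-++ a (true  ∷ H) G h = Σ-++ _ H G (h ∘ suc)
  Σ-++ a (false ∷ H) G h = Σ-++ a H G (h ∘ suc)

  -- `H` consists of the positions from `i` up to, but excluding, `j`. The conclusion is additive
  -- because a semigroup has no subtraction.
  initial-difference : (i j : Fin (suc n)) → i Fin.< j →
    ∃ λ (H : Subset n) → Nonempty H ×
      (∀ a g → sum (sum a (initial i) g) H g ≡ sum a (initial j) g)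
  initial-difference {suc n} zero (suc j) _ =
    initial (suc j) , (zero , here) ,
    λ a g → cong (λ b → sum b (initial (suc j)) g) (Σ-⊥ {suc n} a g)
  initial-difference {suc n} (suc i) (suc j) (s<s i<j)
    with H , (t , t∈H) , eq ← initial-difference i j i<j =
    false ∷ H , (suc t , there t∈H) , λ a g → eq (a ∙ g zero) (g ∘ suc)

  -- Each selected block acts as the single term `q t`. The hypothesis ranges over every start `b`,
  -- since a block is entered with whatever the earlier blocks have accumulated.
  Σ-blocks : ∀ a (H : Subset r) (G : ℕ → Subset n) (h q : ℕ → Carrier) →
    (∀ t b → sum b (G t) (λ s → h (t ℕ.* n ℕ.+ toℕ s)) ≈ b ∙ q t) →
    sum a (blocks H G) (h ∘ toℕ) ≈ sum a H (q ∘ toℕ)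
  Σ-blocks a [] G h q eq = ≈-refl
  Σ-blocks {n = n} a (x ∷ H) G h q eq = go x
    where
    open import Relation.Binary.Reasoning.Setoid setoid
    h′ : ℕ → Carrier
    h′ t = h (n ℕ.+ t)
    -- Block `t` of the shifted sequence `h′` is block `suc t` of `h`, up to reassociating the
    -- index.
    eq′ : ∀ t b → sum b (G (suc t)) (λ s → h′ (t ℕ.* n ℕ.+ toℕ s)) ≈ b ∙ q (suc t)
    eq′ t b = ≈-trans
      (Σ-cong (G (suc t)) ≈-refl
        (λ s → CommutativeSemigroup.reflexive S
          (cong h (sym (ℕ.+-assoc n (t ℕ.* n) (toℕ s))))))
      (eq (suc t) b)
    ih : ∀ b → sum b (blocks H (G ∘ suc)) (h′ ∘ toℕ) ≈ sum b H (q ∘ suc ∘ toℕ)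
    ih b = Σ-blocks b H (G ∘ suc) h′ (q ∘ suc) eq′
    go : ∀ x → sum a (blocks (x ∷ H) G) (h ∘ toℕ) ≈ sum a (x ∷ H) (q ∘ toℕ)
    go true = begin
      sum a (G 0 ++ blocks H (G ∘ suc)) (h ∘ toℕ)
        ≡⟨ Σ-++ a (G 0) (blocks H (G ∘ suc)) h ⟩
      sum (sum a (G 0) (h ∘ toℕ)) (blocks H (G ∘ suc)) (h′ ∘ toℕ)
        ≈⟨ ih _ ⟩
      sum (sum a (G 0) (h ∘ toℕ)) H (q ∘ suc ∘ toℕ)
        ≈⟨ Σ-cong H (eq 0 a) (λ _ → ≈-refl) ⟩
      sum (a ∙ q 0) H (q ∘ suc ∘ toℕ) ∎
    go false = begin
      sum a (⊥ {n} ++ blocks H (G ∘ suc)) (h ∘ toℕ)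
        ≡⟨ Σ-++ a (⊥ {n}) (blocks H (G ∘ suc)) h ⟩
      sum (sum a (⊥ {n}) (h ∘ toℕ)) (blocks H (G ∘ suc)) (h′ ∘ toℕ)
        ≈⟨ ih _ ⟩
      sum (sum a (⊥ {n}) (h ∘ toℕ)) H (q ∘ suc ∘ toℕ)
        ≡⟨ cong (λ b → sum b H (q ∘ suc ∘ toℕ)) (Σ-⊥ {n} a (h ∘ toℕ)) ⟩
      sum a H (q ∘ suc ∘ toℕ) ∎

  -- The matrix form of the k-CR property, with the k columns prolonged to
  -- sequences.
  Matrix-k-CR : ℕ → ℕ → Pred Carrier p → Set _
  Matrix-k-CR k r E = (h : Fin k → ℕ → Carrier) →
    ∃[ a ] ∃ λ (H : Subset r) → Nonempty H × (∀ j → E (sum a H (h j ∘ toℕ)))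

  k-CR⇒matrix : (E : Pred Carrier p) .{{_ : NonZero k}} →
    Is-k-CR S k E → ∃[ r ] NonZero r × Matrix-k-CR k r E
  k-CR⇒matrix {k = suc k} E (r , r≢0 , cr) = r , r≢0 , λ h →
    let s : Fin (suc k) → Seq Carrier
        -- Sequences start at 1 and columns at 0, so `pred` cancels the `suc` in `Is-k-CR`.
        s j n = h j (ℕ.pred n)
    in family s (cr (s zero ∷ List.tabulate (s ∘ suc))
                    (s≤s (ℕ.≤-reflexive (List.length-tabulate (s ∘ suc)))))
    where
    family : {P : Carrier → Subset r → Pred (Seq Carrier) _} (s : Fin (suc k) → Seq Carrier) →
      (∃[ a ] ∃ λ (H : Subset r) → Nonempty H ×
        List⁺.All (P a H) (s zero ∷ List.tabulate (s ∘ suc))) →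
      ∃[ a ] ∃ λ (H : Subset r) → Nonempty H × (∀ j → P a H (s j))
    family s (a , H , ne , p₀ ∷ ps) =
      a , H , ne , λ { zero → p₀ ; (suc j) → ListAll.tabulate⁻ ps j }

  -- A family of fewer than `k` sequences is filled up with copies of its first member, which only
  -- repeats a condition.
  matrix⇒k-CR : (E : Pred Carrier p) →
    ∃[ r ] NonZero r × Matrix-k-CR k r E → Is-k-CR S k E
  matrix⇒k-CR E (r , r≢0 , cr) = r , r≢0 , λ { (f ∷ fs) len≤k →
    let a , H , ne , hits = cr (λ j n → padded f (f ∷ fs) j (suc n))
    in a , H , ne , toAll⁺ (padded-all f (f ∷ fs) len≤k hits) }
    where
    padded : {Y : Set a} → Y → List Y → Fin n → Y
    padded y []       _       = y
    padded y (x ∷ xs) zero    = x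
    padded y (x ∷ xs) (suc j) = padded y xs j
    padded-all : {Y : Set a} {P : Pred Y p} (y : Y) (xs : List Y) →
      List.length xs ℕ.≤ n → (∀ (j : Fin n) → P (padded y xs j)) → ListAll.All P xs
    padded-all y []       _         ps = ListAll.[]
    padded-all y (x ∷ xs) (s≤s len) ps = ps zero ListAll.∷ padded-all y xs len (ps ∘ suc)
    toAll⁺ : {Y : Set a} {P : Pred Y p} {y : Y} {ys : List Y} →
      ListAll.All P (y ∷ ys) → List⁺.All P (y ∷ ys)
    toAll⁺ (p₀ ListAll.∷ ps) = p₀ ∷ ps

-- Serves both to carry sums through multiplication by `d` and to turn sums of vectors into sums of
-- integers under a row functional.
Σ-homo : ∀ {c₁ ℓ₁ c₂ ℓ₂} (S : CommutativeSemigroup c₁ ℓ₁) (T : CommutativeSemigroup c₂ ℓ₂) →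
  let module S = CommutativeSemigroup S; module T = CommutativeSemigroup T in
  (φ : S.Carrier → T.Carrier) → Homomorphic₂ S.Carrier T.Carrier T._≈_ φ S._∙_ T._∙_ →
  ∀ a (H : Subset n) g → φ (_⊹Σ[_]_ S a H g) T.≈ _⊹Σ[_]_ T (φ a) H (φ ∘ g)
Σ-homo S T φ homo a []          g = CommutativeSemigroup.refl T
Σ-homo S T φ homo a (true  ∷ H) g = CommutativeSemigroup.trans T
  (Σ-homo S T φ homo _ H (g ∘ suc))
  (Σ-cong T H (homo a (g zero)) (λ _ → CommutativeSemigroup.refl T))
Σ-homo S T φ homo a (false ∷ H) g = Σ-homo S T φ homo a H (g ∘ suc)

-- Integer sums modulo `d` and the pigeonhole argument.

private
  sumℤ : ℤ → Subset n → (Fin n → ℤ) → ℤ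
  sumℤ = _⊹Σ[_]_ +-commutativeSemigroup

sumℤ-shift : ∀ a (H : Subset n) g → sumℤ a H g ≡ a ℤ.+ sumℤ 0ℤ H g
sumℤ-shift a H g = trans
  (cong (λ b → sumℤ b H g) (sym (ℤ.+-identityʳ a)))
  (Σ-∙ +-commutativeSemigroup a 0ℤ H g)

residue : (d : ℕ) .{{_ : NonZero d}} → ℤ → Fin d
residue d a = Fin.fromℕ< (ℤ.n%ℕd<d a d)

-- Equal remainders cancel when the two divisions with remainder are subtracted, leaving `d` times
-- the difference of the quotients. In use, `b` is the sum over the gap between two prefixes.
residue-≡ : (d : ℕ) .{{_ : NonZero d}} (a b : ℤ) →
  residue d a ≡ residue d (a ℤ.+ b) → ∃ λ q → b ≡ + d ℤ.* q
residue-≡ d a b eq = (a ℤ.+ b) ℤ./ℕ d ℤ.- a ℤ./ℕ d , (begin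
  b
    ≡⟨ difference a b ⟩
  (a ℤ.+ b) ℤ.- a
    ≡⟨ cong₂ ℤ._-_ (ℤ.a≡a%ℕn+[a/ℕn]*n (a ℤ.+ b) d) (ℤ.a≡a%ℕn+[a/ℕn]*n a d) ⟩
  (+ ((a ℤ.+ b) ℤ.%ℕ d) ℤ.+ (a ℤ.+ b) ℤ./ℕ d ℤ.* + d) ℤ.- (+ (a ℤ.%ℕ d) ℤ.+ a ℤ./ℕ d ℤ.* + d)
    ≡⟨ cong (λ s → (+ s ℤ.+ (a ℤ.+ b) ℤ./ℕ d ℤ.* + d) ℤ.- (+ (a ℤ.%ℕ d) ℤ.+ a ℤ./ℕ d ℤ.* + d))
         (Fin.fromℕ<-injective _ _ (ℤ.n%ℕd<d a d) (ℤ.n%ℕd<d (a ℤ.+ b) d) eq) ⟨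
  (+ (a ℤ.%ℕ d) ℤ.+ (a ℤ.+ b) ℤ./ℕ d ℤ.* + d) ℤ.- (+ (a ℤ.%ℕ d) ℤ.+ a ℤ./ℕ d ℤ.* + d)
    ≡⟨ factor (+ (a ℤ.%ℕ d)) ((a ℤ.+ b) ℤ./ℕ d) (a ℤ./ℕ d) (+ d) ⟩
  + d ℤ.* ((a ℤ.+ b) ℤ./ℕ d ℤ.- a ℤ./ℕ d) ∎)
  where
  open ≡-Reasoning
  difference : ∀ a b → b ≡ (a ℤ.+ b) ℤ.- a
  difference = solve-∀
  factor : ∀ s x y e → (s ℤ.+ x ℤ.* e) ℤ.- (s ℤ.+ y ℤ.* e) ≡ e ℤ.* (x ℤ.- y)
  factor = solve-∀

divisible-subsum : (d : ℕ) .{{_ : NonZero d}} (g : Fin k → Fin (d ^ k) → ℤ) →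
  ∃ λ (H : Subset (d ^ k)) → Nonempty H × (∀ j → ∃ λ q → sumℤ 0ℤ H (g j) ≡ + d ℤ.* q)
divisible-subsum {k} d g =
  -- `funToFin` codes a residue vector as an element of `Fin (d ^ k)`, the form the pigeonhole
  -- principle takes; decoding gives back the agreement in each coordinate.
  let i , i′ , i<i′ , same = Fin.pigeonhole (ℕ.n<1+n (d ^ k)) (Fin.funToFin ∘ residues)
      H , ne , telescope = initial-difference +-commutativeSemigroup i i′ i<i′
  in H , ne , λ j → residue-≡ d (partial i j) (sumℤ 0ℤ H (g j)) (begin
    residues i j
      ≡⟨ Fin.finToFun-funToFin (residues i) j ⟨
    Fin.finToFun (Fin.funToFin (residues i)) j
      ≡⟨ cong (λ f → Fin.finToFun f j) same ⟩
    Fin.finToFun (Fin.funToFin (residues i′)) j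
      ≡⟨ Fin.finToFun-funToFin (residues i′) j ⟩
    residues i′ j
      ≡⟨ cong (residue d) (telescope 0ℤ (g j)) ⟨
    residue d (sumℤ (partial i j) H (g j))
      ≡⟨ cong (residue d) (sumℤ-shift (partial i j) H (g j)) ⟩
    residue d (partial i j ℤ.+ sumℤ 0ℤ H (g j)) ∎)
  where
  open ≡-Reasoning
  partial : Fin (suc (d ^ k)) → Fin k → ℤ
  partial i j = sumℤ 0ℤ (initial i) (g j)
  residues : Fin (suc (d ^ k)) → Fin k → Fin d
  residues i j = residue d (partial i j)

-- Besides d B being k-CR, the shift can be taken in d ℤ.
scaled-CR : (d : ℕ) .{{_ : NonZero d}} (B : Pred ℤ p) →
  Matrix-k-CR +-commutativeSemigroup k r B →
  (h : Fin k → ℕ → ℤ) →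
  ∃[ a ] ∃ λ (H : Subset (r ℕ.* d ^ k)) → Nonempty H ×
    (∀ j → ∃ λ b → B b × sumℤ (+ d ℤ.* a) H (h j ∘ toℕ) ≡ + d ℤ.* b)
scaled-CR {k = k} d B cr h =
  -- The set returned for the block quotients selects whole blocks; scaling by `d` leads back to
  -- sums of `h`.
  let a , H , ne , hits = cr quotient
  in a , blocks H G , blocks-nonempty G ne (proj₁ ∘ proj₂ ∘ block) ,
     λ j → sumℤ a H (quotient j ∘ toℕ) , hits j , (begin
       sumℤ (+ d ℤ.* a) (blocks H G) (h j ∘ toℕ)
         ≡⟨ Σ-blocks +-commutativeSemigroup _ H G (h j) (λ t → + d ℤ.* quotient j t) (block-sum j) ⟩
       sumℤ (+ d ℤ.* a) H (λ t → + d ℤ.* quotient j (toℕ t))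
         ≡⟨ Σ-homo +-commutativeSemigroup +-commutativeSemigroup
              (+ d ℤ.*_) (ℤ.*-distribˡ-+ (+ d)) a H (quotient j ∘ toℕ) ⟨
       + d ℤ.* sumℤ a H (quotient j ∘ toℕ) ∎)
  where
  open ≡-Reasoning
  g : ℕ → Fin k → Fin (d ^ k) → ℤ
  g t j s = h j (t ℕ.* d ^ k ℕ.+ toℕ s)
  block : ∀ t → ∃ λ (H : Subset (d ^ k)) →
    Nonempty H × (∀ j → ∃ λ q → sumℤ 0ℤ H (g t j) ≡ + d ℤ.* q)
  block t = divisible-subsum d (g t)
  G : ℕ → Subset (d ^ k)
  G = proj₁ ∘ block
  quotient : Fin k → ℕ → ℤ
  quotient j t = proj₁ (proj₂ (proj₂ (block t)) j)
  block-sum : ∀ j t b → sumℤ b (G t) (g t j) ≡ b ℤ.+ + d ℤ.* quotient j t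
  block-sum j t b = trans (sumℤ-shift b (G t) (g t j))
    (cong (λ c → b ℤ.+ c) (proj₂ (proj₂ (proj₂ (block t)) j)))

-- Integral functionals and clearing denominators.

infix 8 _·_ _·ℚ_

_·_ : Vec ℤ n → Vec ℤ n → ℤ
c · y = foldr′ ℤ._+_ 0ℤ (zipWith ℤ._*_ c y)

_·ℚ_ : Vec ℚ n → Vec ℚ n → ℚ
c ·ℚ y = foldr′ ℚ._+_ 0ℚ (zipWith ℚ._*_ c y)

·-homo : (c x y : Vec ℤ n) → c · zipWith ℤ._+_ x y ≡ c · x ℤ.+ c · y
·-homo [] [] [] = refl
·-homo (c ∷ cs) (x ∷ xs) (y ∷ ys) =
  trans (cong (λ s → c ℤ.* (x ℤ.+ y) ℤ.+ s) (·-homo cs xs ys))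
        (rearrange c x y (cs · xs) (cs · ys))
  where
  rearrange : ∀ c x y s t →
    c ℤ.* (x ℤ.+ y) ℤ.+ (s ℤ.+ t) ≡ (c ℤ.* x ℤ.+ s) ℤ.+ (c ℤ.* y ℤ.+ t)
  rearrange = solve-∀

fromℤ-injective : ∀ {a b} → fromℤ a ≡ fromℤ b → a ≡ b
fromℤ-injective = cong ↥_

-- Addition in ℚ normalises its result, so the equation is checked by cross-multiplication in ℚᵘ,
-- where all denominators are 1.
fromℤ-homo-+ : ∀ a b → fromℤ (a ℤ.+ b) ≡ fromℤ a ℚ.+ fromℤ b
fromℤ-homo-+ a b = ℚ.toℚᵘ-injective (ℚᵘ.≃-trans
  (ℚᵘ.*≡* (eq a b))
  (ℚᵘ.≃-sym (ℚ.toℚᵘ-homo-+ (fromℤ a) (fromℤ b))))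
  where
  eq : ∀ a b → (a ℤ.+ b) ℤ.* + 1 ≡ (a ℤ.* + 1 ℤ.+ b ℤ.* + 1) ℤ.* + 1
  eq = solve-∀

fromℤ-homo-* : ∀ a b → fromℤ (a ℤ.* b) ≡ fromℤ a ℚ.* fromℤ b
fromℤ-homo-* a b = ℚ.toℚᵘ-injective (ℚᵘ.≃-trans
  (ℚᵘ.*≡* refl)
  (ℚᵘ.≃-sym (ℚ.toℚᵘ-homo-* (fromℤ a) (fromℤ b))))

*-cancelˡ-fromℤ : (d : ℕ) .{{_ : NonZero d}} {x y : ℚ} →
  fromℤ (+ d) ℚ.* x ≡ fromℤ (+ d) ℚ.* y → x ≡ y
-- Matching on `suc _` exhibits the factor as positive, so it cancels from an inequality in each
-- direction.
*-cancelˡ-fromℤ d@(suc _) eq = ℚ.≤-antisym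
  (ℚ.*-cancelˡ-≤-pos (fromℤ (+ d)) (ℚ.≤-reflexive eq))
  (ℚ.*-cancelˡ-≤-pos (fromℤ (+ d)) (ℚ.≤-reflexive (sym eq)))

Integral : ℕ → Pred ℚ _
Integral d q = ∃ λ c → fromℤ (+ d) ℚ.* q ≡ fromℤ c

integral-↧ : ∀ q → Integral (↧ₙ q) q
-- Matching on the record lets `toℚᵘ q` unfold to its numerator and denominator.
integral-↧ q@record{} = ↥ q , ℚ.toℚᵘ-injective (ℚᵘ.≃-trans
  (ℚ.toℚᵘ-homo-* (fromℤ (↧ q)) q) (ℚᵘ.*≡* (eq (↧ q) (↥ q))))
  where
  eq : ∀ d n → (d ℤ.* n) ℤ.* + 1 ≡ n ℤ.* (+ 1 ℤ.* d)
  eq = solve-∀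

integral-∣ : ∀ q {m n} → m ∣ n → Integral m q → Integral n q
integral-∣ q {m} (divides e refl) (c , eq) = + e ℤ.* c , (begin
  fromℤ (+ (e ℕ.* m)) ℚ.* q
    ≡⟨ cong (λ z → fromℤ z ℚ.* q) (ℤ.pos-* e m) ⟩
  fromℤ (+ e ℤ.* + m) ℚ.* q
    ≡⟨ cong (ℚ._* q) (fromℤ-homo-* (+ e) (+ m)) ⟩
  (fromℤ (+ e) ℚ.* fromℤ (+ m)) ℚ.* q
    ≡⟨ ℚ.*-assoc (fromℤ (+ e)) (fromℤ (+ m)) q ⟩
  fromℤ (+ e) ℚ.* (fromℤ (+ m) ℚ.* q)
    ≡⟨ cong (fromℤ (+ e) ℚ.*_) eq ⟩
  fromℤ (+ e) ℚ.* fromℤ c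
    ≡⟨ fromℤ-homo-* (+ e) c ⟨
  fromℤ (+ e ℤ.* c) ∎)
  where open ≡-Reasoning

-- The product of the individual witnesses is a multiple of each. Stated for a general `P` so that
-- it applies first to the entries of a row and then to the rows.
common-multiple : {P : ℕ → Pred X p} →
  (∀ x {m n} → m ∣ n → P m x → P n x) →
  (∀ x → ∃ λ d → NonZero d × P d x) →
  (xs : Vec X n) → ∃ λ d → NonZero d × VecAll.All (P d) xs
common-multiple mono each [] = 1 , _ , []
common-multiple mono each (x ∷ xs)
  with d , d≢0 , px ← each x | e , e≢0 , pxs ← common-multiple mono each xs =
  d ℕ.* e , ℕ.m*n≢0 d e {{d≢0}} {{e≢0}} ,
  mono x (m∣m*n e) px ∷ VecAll.map (λ {y} → mono y (n∣m*n d)) pxs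

common-denominator : (A : Matrix ℚ m n) →
  ∃ λ d → NonZero d × VecAll.All (VecAll.All (Integral d)) A
common-denominator = common-multiple
  (λ _ m∣n → VecAll.map (λ {q} → integral-∣ q m∣n))
  (common-multiple integral-∣ (λ q → ↧ₙ q , _ , integral-↧ q))

-- The coefficients `c` are the integers `d` times the entries of the row; `d` distributes over the
-- sum and clears each term.
integral-functional : (d : ℕ) {row : Vec ℚ n} → VecAll.All (Integral d) row →
  ∃ λ c → ∀ y → fromℤ (+ d) ℚ.* (row ·ℚ map fromℤ y) ≡ fromℤ (c · y)
integral-functional d [] = [] , λ { [] → ℚ.*-zeroʳ (fromℤ (+ d)) }
integral-functional d {q ∷ row} ((c , eq) ∷ int) with cs , eqs ← integral-functional d int =
  c ∷ cs , λ { (y ∷ ys) → begin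
    fromℤ (+ d) ℚ.* (q ℚ.* fromℤ y ℚ.+ row ·ℚ map fromℤ ys)
      ≡⟨ ℚ.*-distribˡ-+ (fromℤ (+ d)) (q ℚ.* fromℤ y) _ ⟩
    fromℤ (+ d) ℚ.* (q ℚ.* fromℤ y) ℚ.+ fromℤ (+ d) ℚ.* (row ·ℚ map fromℤ ys)
      ≡⟨ cong₂ ℚ._+_ (sym (ℚ.*-assoc (fromℤ (+ d)) q (fromℤ y))) (eqs ys) ⟩
    (fromℤ (+ d) ℚ.* q) ℚ.* fromℤ y ℚ.+ fromℤ (cs · ys)
      ≡⟨ cong (λ z → z ℚ.* fromℤ y ℚ.+ fromℤ (cs · ys)) eq ⟩
    fromℤ c ℚ.* fromℤ y ℚ.+ fromℤ (cs · ys)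
      ≡⟨ cong (ℚ._+ fromℤ (cs · ys)) (fromℤ-homo-* c y) ⟨
    fromℤ (c ℤ.* y) ℚ.+ fromℤ (cs · ys)
      ≡⟨ fromℤ-homo-+ (c ℤ.* y) (cs · ys) ⟨
    fromℤ (c ℤ.* y ℤ.+ cs · ys) ∎ }
  where open ≡-Reasoning

-- `C i` stands for row `i` of `d A`. `cleared` reads values off a known integral image; `uncleared`
-- assembles the image that `Preimage` demands from values found row by row, hence its function `b`.
record ClearedDenominators (A : Matrix ℚ m n) : Set where
  field
    d          : ℕ
    d≢0        : NonZero d
    C          : Fin m → Vec ℤ n
    cleared    : ∀ y b → A *ᵥ map fromℤ y ≡ map fromℤ b → ∀ i → C i · y ≡ + d ℤ.* lookup b i
    uncleared  : ∀ y (b : Fin m → ℤ) → (∀ i → C i · y ≡ + d ℤ.* b i) →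
                 A *ᵥ map fromℤ y ≡ map fromℤ (tabulate b)

clear-denominators : (A : Matrix ℚ m n) → ClearedDenominators A
clear-denominators {m = m} {n = n} A with d , d≢0 , int ← common-denominator A = record
  { d         = d
  ; d≢0       = d≢0
  ; C         = C
  ; cleared   = λ y b Ay≡b i → fromℤ-injective (begin
      fromℤ (C i · y)                              ≡⟨ scaled i y ⟨
      fromℤ (+ d) ℚ.* (lookup A i ·ℚ map fromℤ y)  ≡⟨ cong (fromℤ (+ d) ℚ.*_) (begin
        lookup A i ·ℚ map fromℤ y                    ≡⟨ Vec.lookup-map i (_·ℚ map fromℤ y) A ⟨
        lookup (A *ᵥ map fromℤ y) i                  ≡⟨ cong (λ z → lookup z i) Ay≡b ⟩
        lookup (map fromℤ b) i                       ≡⟨ Vec.lookup-map i fromℤ b ⟩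
        fromℤ (lookup b i)                           ∎) ⟩
      fromℤ (+ d) ℚ.* fromℤ (lookup b i)           ≡⟨ fromℤ-homo-* (+ d) (lookup b i) ⟨
      fromℤ (+ d ℤ.* lookup b i)                   ∎)
  ; uncleared = λ y b Cy≡db → begin
      A *ᵥ map fromℤ y                             ≡⟨ cong (_*ᵥ map fromℤ y) (Vec.tabulate∘lookup A) ⟨
      tabulate (lookup A) *ᵥ map fromℤ y           ≡⟨ Vec.tabulate-∘ (_·ℚ map fromℤ y) (lookup A) ⟨
      tabulate (λ i → lookup A i ·ℚ map fromℤ y)   ≡⟨ Vec.tabulate-cong (λ i →
          *-cancelˡ-fromℤ d {{d≢0}} (begin
            fromℤ (+ d) ℚ.* (lookup A i ·ℚ map fromℤ y)  ≡⟨ scaled i y ⟩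
            fromℤ (C i · y)                              ≡⟨ cong fromℤ (Cy≡db i) ⟩
            fromℤ (+ d ℤ.* b i)                          ≡⟨ fromℤ-homo-* (+ d) (b i) ⟩
            fromℤ (+ d) ℚ.* fromℤ (b i)                  ∎)) ⟩
      tabulate (fromℤ ∘ b)                         ≡⟨ Vec.tabulate-∘ fromℤ b ⟩
      map fromℤ (tabulate b)                       ∎
  }
  where
  open ≡-Reasoning
  functional : ∀ i → ∃ λ c → ∀ y →
    fromℤ (+ d) ℚ.* (lookup A i ·ℚ map fromℤ y) ≡ fromℤ (c · y)
  functional i = integral-functional d (VecAll.lookup⁺ int i)
  C : Fin m → Vec ℤ n
  C = proj₁ ∘ functional
  scaled : ∀ i y → fromℤ (+ d) ℚ.* (lookup A i ·ℚ map fromℤ y) ≡ fromℤ (C i · y)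
  scaled = proj₂ ∘ functional

-- From `B` to its preimage: all rows of all sequences at once.

corollary2p5 : {p : Level} (u v : ℕ) .{{_ : NonZero u}} .{{_ : NonZero v}}
    (A : Matrix ℚ u v) (B : Pred ℤ p) →
    IsCR +-commutativeSemigroup B →
    ((a : ℤ) → ∃ λ (x : Vec ℤ v) → A *ᵥ map fromℤ x ≡ map fromℤ (replicate u a)) →
    IsCR (ℤ^-commutativeSemigroup v) (Preimage A B)
corollary2p5 u v A B crB solve k =
  -- One shift and one index set must serve every pair of a sequence and a row of `A`, so `B` is
  -- used with `k * u` sequences. The bound counts `r` blocks of length `d ^ (k * u)`.
  let r , r≢0 , cr = k-CR⇒matrix +-commutativeSemigroup B {{ku≢0}} (crB (k ℕ.* u) {{ku≢0}})
  in matrix⇒k-CR ℤᵛ (Preimage A B)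
       (r ℕ.* d ^ (k ℕ.* u) , ℕ.m*n≢0 r _ {{r≢0}} {{ℕ.m^n≢0 d (k ℕ.* u) {{d≢0}}}} , preimage-CR cr)
  where
  open ≡-Reasoning
  open ClearedDenominators (clear-denominators A)
  ℤᵛ = ℤ^-commutativeSemigroup v
  ku≢0 : NonZero (k ℕ.* u)
  ku≢0 = ℕ.m*n≢0 k u
  preimage-CR : Matrix-k-CR +-commutativeSemigroup (k ℕ.* u) r B →
    Matrix-k-CR ℤᵛ k (r ℕ.* d ^ (k ℕ.* u)) (Preimage A B)
  preimage-CR cr f =
    let a , H , ne , hits = scaled-CR d {{d≢0}} B cr h
        -- Since `A x` is constantly `a`, every functional `C i` sends `x` to the same shift `d a`,
        -- the one that `scaled-CR` supplies.
        x , Ax≡a          = solve a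
        y                 = λ j → _⊹Σ[_]_ ℤᵛ x H (f j ∘ toℕ)
        value : ∀ j i → ∃ λ b → B b × C i · y j ≡ + d ℤ.* b
        value j i =
          let b , b∈B , eq = hits (Fin.combine j i)
          in b , b∈B , (begin
            C i · y j
              ≡⟨ Σ-homo ℤᵛ +-commutativeSemigroup (C i ·_) (·-homo (C i)) x H (f j ∘ toℕ) ⟩
            sumℤ (C i · x) H (λ t → C i · f j (toℕ t))
              ≡⟨ cong (λ z → sumℤ z H (λ t → C i · f j (toℕ t)))
                   (trans (cleared x _ Ax≡a i) (cong (+ d ℤ.*_) (Vec.lookup-replicate i a))) ⟩
            sumℤ (+ d ℤ.* a) H (λ t → C i · f j (toℕ t))
              ≡⟨ cong (λ (j′ , i′) → sumℤ (+ d ℤ.* a) H (λ t → C i′ · f j′ (toℕ t)))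
                   (Fin.remQuot-combine j i) ⟨
            sumℤ (+ d ℤ.* a) H (h (Fin.combine j i) ∘ toℕ)
              ≡⟨ eq ⟩
            + d ℤ.* b ∎)
    in x , H , ne , λ j →
      tabulate (proj₁ ∘ value j) ,
      VecAll.tabulate⁺ {P = B} (proj₁ ∘ proj₂ ∘ value j) ,
      uncleared (y j) (proj₁ ∘ value j) (proj₂ ∘ proj₂ ∘ value j)
    where
    h : Fin (k ℕ.* u) → ℕ → ℤ
    h l n = let j , i = Fin.remQuot u l in C i · f j n
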